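{- For $n\ge1$ let $P^B_n(x_0,x_1,y_0,y_1)=\sum_{\sigma\in\mathcal{B}_n}x_0^{\mathrm{asc}_0\sigma}x_1^{\mathrm{asc}_1\sigma}y_0^{\mathrm{des}_0\sigma}y_1^{\mathrm{des}_1\sigma}$ and $\alpha=(y_0-x_0)(y_1-x_1)$. Then $$\sum_{n\geq 1}P^B_{2n}(x_0, x_1, y_0, y_1)\frac{t^{2n}}{(2n)!}=\frac{(x_0y_1+x_1y_0)\sum_{n\geq 0}\frac{\alpha^n (2t)^{2n}}{(2n)!}+\sum_{n\geq 0}\frac{\alpha^{n+1} t^{2n}}{(2n)!}-(x_1x_0+y_0y_1)}{(x_0x_1+y_0y_1)-(y_1x_0+x_1y_0)\sum_{n\geq 0}\frac{\alpha^n (2t)^{2n}}{(2n)!}},$$ and $$\sum_{n\geq 1}P^B_{2n-1}(x_0, x_1, y_0, y_1)\frac{t^{2n-1}}{(2n-1)!}=\frac{(y_0^2-x_0^2)(y_1-x_1)\,\sum_{n\geq 0}\frac{\alpha^{n} t^{2n+1}}{(2n+1)!}}{(x_0x_1+y_0y_1)-(x_0y_1+x_1y_0)\sum_{n\geq 0}\frac{\alpha^n (2t)^{2n}}{(2n)!}}.$$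
   Context: $\mathcal{B}_n$ is the set of signed permutations, i.e. bijections $\sigma$ of $\{\pm1,\dots,\pm n\}$ with $\sigma(-i)=-\sigma(i)$; each $\sigma$ is identified with the word $\sigma(0)\sigma(1)\cdots\sigma(n)$ where $\sigma(0)=0$. A position $i\in\{0,1,\dots,n-1\}$ is a descent if $\sigma(i)>\sigma(i+1)$ and an ascent if $\sigma(i)<\sigma(i+1)$. $\mathrm{des}_1\sigma,\mathrm{des}_0\sigma$ are the numbers of descents at odd, resp. even (including $0$), positions; $\mathrm{asc}_1\sigma,\mathrm{asc}_0\sigma$ likewise for ascents. -}

module Defs where

open import Algebra.Bundles using (CommutativeRing)
open import Data.Bool using (Bool; true; false; not; if_then_else_)
open import Data.Nat as ℕ using (ℕ; zero; suc; _∸_)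
open import Data.Nat.Combinatorics using (_C_)
open import Data.Integer as ℤ using (ℤ; ∣_∣)
open import Data.List using (List; []; _∷_; map; concatMap; filter; upTo; foldr)
open import Relation.Nullary.Decidable using (does)
import Data.List.Relation.Unary.Unique.DecPropositional ℕ._≟_ as UniqueℕDec

-- Signed permutations of [n], as words σ(1)⋯σ(n) of integers.
-- A signed permutation σ is determined by (σ(1),…,σ(n)); the words that
-- arise are exactly those with letters in {±1,…,±n} whose absolute
-- values are pairwise distinct.

signedLetters : ℕ → List ℤ
signedLetters n = concatMap (λ k → ℤ.+ (suc k) ∷ ℤ.- (ℤ.+ (suc k)) ∷ []) (upTo n)

words : ℕ → ℕ → List (List ℤ)
words n zero    = [] ∷ []
words n (suc m) = concatMap (λ w → map (_∷ w) (signedLetters n)) (words n m)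

signedPerms : ℕ → List (List ℤ)
signedPerms n = filter (λ w → UniqueℕDec.unique? (map ∣_∣ w)) (words n n)

module _ {c ℓ} (R : CommutativeRing c ℓ) where
  open CommutativeRing R

  pow : Carrier → ℕ → Carrier
  pow a zero    = 1#
  pow a (suc k) = a * pow a k

  natR : ℕ → Carrier
  natR zero    = 0#
  natR (suc k) = 1# + natR k

  sumR : List Carrier → Carrier
  sumR = foldr _+_ 0#

  -- weight x₀^{asc₀} x₁^{asc₁} y₀^{des₀} y₁^{des₁} of the word
  -- σ(0)σ(1)⋯σ(n) with σ(0)=0.  `ev` records whether the current position
  -- i (of the pair σ(i),σ(i+1)) is even; `prev` is σ(i).
  weightFrom : (x₀ x₁ y₀ y₁ : Carrier) → Bool → ℤ → List ℤ → Carrier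
  weightFrom x₀ x₁ y₀ y₁ ev prev []      = 1#
  weightFrom x₀ x₁ y₀ y₁ ev prev (a ∷ w) =
    (if does (prev ℤ.<? a)
       then (if ev then x₀ else x₁)
       else (if ev then y₀ else y₁))
    * weightFrom x₀ x₁ y₀ y₁ (not ev) a w

  weight : (x₀ x₁ y₀ y₁ : Carrier) → List ℤ → Carrier
  weight x₀ x₁ y₀ y₁ w = weightFrom x₀ x₁ y₀ y₁ true (ℤ.+ 0) w

  PB : ℕ → (x₀ x₁ y₀ y₁ : Carrier) → Carrier
  PB n x₀ x₁ y₀ y₁ = sumR (map (weight x₀ x₁ y₀ y₁) (signedPerms n))

  -- Formal power series in t, in exponential form: F m is the
  -- coefficient of t^m / m!.
  Series : Set c
  Series = ℕ → Carrier

  _⊛_ : Series → Series → Series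
  (F ⊛ G) m = sumR (map (λ k → natR (m C k) * (F k * G (m ∸ k))) (upTo (suc m)))

  _⊕_ : Series → Series → Series
  (F ⊕ G) m = F m + G m

  _⊖_ : Series → Series → Series
  (F ⊖ G) m = F m - G m

  _·ₛ_ : Carrier → Series → Series
  (a ·ₛ F) m = a * F m

  constS : Carrier → Series
  constS a zero    = a
  constS a (suc m) = 0#

  -- evenS f = Σ_{n≥0} f n · t^{2n}/(2n)!
  evenS : (ℕ → Carrier) → Series
  evenS f zero          = f 0
  evenS f (suc zero)    = 0#
  evenS f (suc (suc m)) = evenS (λ n → f (suc n)) m

  oddS : (ℕ → Carrier) → Series
  oddS f zero    = 0#
  oddS f (suc m) = evenS f m

  PBevenCoeff : (x₀ x₁ y₀ y₁ : Carrier) → ℕ → Carrier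
  PBevenCoeff x₀ x₁ y₀ y₁ zero    = 0#
  PBevenCoeff x₀ x₁ y₀ y₁ (suc k) = PB (2 ℕ.* suc k) x₀ x₁ y₀ y₁

{-# OPTIONS --safe #-}
module Submission where

open import Defs
open import Algebra.Bundles using (CommutativeRing)
open import Data.Bool using (Bool; true; false; not; if_then_else_)
open import Data.Bool.Properties using (not-involutive)
open import Data.Integer as ℤ using (ℤ; ∣_∣)
open import Data.List using (List; []; _∷_; _++_; map; concatMap; filter; applyUpTo; upTo)
open import Data.List.Properties using (map-∘)
open import Data.List.Relation.Unary.All as All using (All; []; _∷_)
open import Data.List.Relation.Unary.AllPairs using ([]; _∷_)
import Data.Nat as ℕ
open import Data.Nat using (ℕ; zero; suc; pred; _∸_; _<ᵇ_; z≤n; s≤s)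
import Data.List.Relation.Unary.Unique.DecPropositional ℕ._≟_ as UniqueDec
open import Data.List.Relation.Unary.Unique.Propositional using (Unique)
import Data.Nat.Properties as ℕₚ
open import Data.Product using (_×_; _,_; proj₂)
open import Data.Sum using (inj₁; inj₂)
open import Function using (_∘_)
open import Relation.Binary.PropositionalEquality as ≡ using (_≡_; _≢_)
open import Relation.Nullary using (yes; no; contradiction)
open import Relation.Nullary.Decidable using (does; dec-true; dec-false)
open import Relation.Unary using (Pred; Decidable)
import Algebra.Solver.Ring.NaturalCoefficients.Default as SemiringSolver
import Relation.Binary.Reasoning.Setoid as SetoidReasoning

-- Read a signed permutation from left to right.  The weight still to come only
-- depends on the parity of the position, the sign s of the current letter, the
-- number r of unused absolute values, and the number j of those that are smaller
-- than the current one.  Call it f s r j e, where e is the parity.  As a function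
-- of j it satisfies f s r (j+1) e - f s r j e = d f s (r-1) j (not e), where d is
-- ± (y_e - x_e); so it is determined by the values Z_e r = f s r 0 e, which do not
-- depend on s and satisfy Z_0 n = P^B_n.  Summing over all next letters gives, for
-- exponential generating functions and with C = Σ αⁿ t²ⁿ/(2n)! and
-- S = Σ αⁿ t²ⁿ⁺¹/(2n+1)!,
--   C Z_e = 1 + (x_e + y_e) S Z_{1-e}.
-- Since C² = 1 + α S² and Σ αⁿ (2t)²ⁿ/(2n)! = 1 + 2 α S², eliminating Z_1 and
-- multiplying by α gives
--   Den Z_0 = α C + α (x_0 + y_0) S,
-- and the two formulas are the even and odd parts, because Den is even.

-- Finite sums over initial segments.

module FiniteSums {c ℓ} (R : CommutativeRing c ℓ) where
  open CommutativeRing R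
  open SetoidReasoning setoid
  open SemiringSolver commutativeSemiring using (solve; _:=_; _:+_)

  -- Splitting off the last term lets prefix sums grow by computation when their bound increases,
  -- which is the recurrence that `diagonal` asks of `u`.
  Σ< : ℕ → (ℕ → Carrier) → Carrier
  Σ< zero    f = 0#
  Σ< (suc n) f = Σ< n f + f n

  Σ<-cong : ∀ n {f g} → (∀ {k} → k ℕ.< n → f k ≈ g k) → Σ< n f ≈ Σ< n g
  Σ<-cong zero    h = refl
  Σ<-cong (suc n) h = +-cong (Σ<-cong n (λ k<n → h (ℕₚ.m<n⇒m<1+n k<n))) (h ℕₚ.≤-refl)

  Σ<-+ : ∀ n f g → Σ< n (λ k → f k + g k) ≈ Σ< n f + Σ< n g
  Σ<-+ zero    f g = sym (+-identityʳ 0#)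
  Σ<-+ (suc n) f g = begin
    Σ< n (λ k → f k + g k) + (f n + g n)  ≈⟨ +-congʳ (Σ<-+ n f g) ⟩
    (Σ< n f + Σ< n g) + (f n + g n)
      ≈⟨ solve 4 (λ a b c d → (a :+ b) :+ (c :+ d) := (a :+ c) :+ (b :+ d)) refl _ _ _ _ ⟩
    (Σ< n f + f n) + (Σ< n g + g n)       ∎

  Σ<-* : ∀ n a f → Σ< n (λ k → a * f k) ≈ a * Σ< n f
  Σ<-* zero    a f = sym (zeroʳ a)
  Σ<-* (suc n) a f = trans (+-congʳ (Σ<-* n a f)) (sym (distribˡ a _ _))

  Σ<-suc : ∀ n f → Σ< (suc n) f ≈ f 0 + Σ< n (f ∘ suc)
  Σ<-suc zero    f = +-comm 0# (f 0)
  Σ<-suc (suc n) f = trans (+-congʳ (Σ<-suc n f)) (+-assoc _ _ _)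

  sumR-applyUpTo : ∀ {A : Set} (g : A → Carrier) (f : ℕ → A) n →
                   sumR R (map g (applyUpTo f n)) ≈ Σ< n (g ∘ f)
  sumR-applyUpTo g f zero    = refl
  sumR-applyUpTo g f (suc n) =
    trans (+-congˡ (sumR-applyUpTo g (f ∘ suc) n)) (sym (Σ<-suc n (g ∘ f)))

-- The ring of exponential generating functions.

module ExponentialSeries {c ℓ} (R : CommutativeRing c ℓ) where
  open import Data.Nat.Combinatorics using (_C_; nCk+nC[k+1]≡[n+1]C[k+1]; k>n⇒nCk≡0)
  open CommutativeRing R
  open FiniteSums R
  open SetoidReasoning setoid
  open SemiringSolver commutativeSemiring using (solve; _:=_; _:+_)

  infix 4 _≋_
  _≋_ : Series R → Series R → Set ℓ
  F ≋ G = ∀ m → F m ≈ G m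

  infixl 6 _⊞_
  _⊞_ : Series R → Series R → Series R
  (F ⊞ G) m = F m + G m

  ∂ : Series R → Series R
  ∂ F m = F (suc m)

  -- Multiplication by the Leibniz rule makes the ring laws structural inductions.
  infixl 7 _⊙_
  _⊙_ : Series R → Series R → Series R
  (F ⊙ G) zero    = F 0 * G 0
  (F ⊙ G) (suc m) = (∂ F ⊙ G) m + (F ⊙ ∂ G) m

  ⊙-cong : ∀ {F F′ G G′} → F ≋ F′ → G ≋ G′ → F ⊙ G ≋ F′ ⊙ G′
  ⊙-cong p q zero    = *-cong (p 0) (q 0)
  ⊙-cong p q (suc m) = +-cong (⊙-cong (p ∘ suc) q m) (⊙-cong p (q ∘ suc) m)

  ⊙-comm : ∀ F G → F ⊙ G ≋ G ⊙ F
  ⊙-comm F G zero    = *-comm _ _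
  ⊙-comm F G (suc m) = trans (+-cong (⊙-comm (∂ F) G m) (⊙-comm F (∂ G) m)) (+-comm _ _)

  ⊙-distribʳ : ∀ H F G → (F ⊞ G) ⊙ H ≋ (F ⊙ H) ⊞ (G ⊙ H)
  ⊙-distribʳ H F G zero    = distribʳ _ _ _
  ⊙-distribʳ H F G (suc m) =
    trans (+-cong (⊙-distribʳ H (∂ F) (∂ G) m) (⊙-distribʳ (∂ H) F G m))
          (solve 4 (λ a b c d → (a :+ b) :+ (c :+ d) := (a :+ c) :+ (b :+ d)) refl _ _ _ _)

  ⊙-distribˡ : ∀ H F G → H ⊙ (F ⊞ G) ≋ (H ⊙ F) ⊞ (H ⊙ G)
  ⊙-distribˡ H F G m =
    trans (⊙-comm H (F ⊞ G) m)
          (trans (⊙-distribʳ H F G m) (+-cong (⊙-comm F H m) (⊙-comm G H m)))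

  ⊙-assoc : ∀ F G H → (F ⊙ G) ⊙ H ≋ F ⊙ (G ⊙ H)
  ⊙-assoc F G H zero    = *-assoc _ _ _
  ⊙-assoc F G H (suc m) = begin
    (((∂ F ⊙ G) ⊞ (F ⊙ ∂ G)) ⊙ H) m + ((F ⊙ G) ⊙ ∂ H) m
      ≈⟨ +-congʳ (⊙-distribʳ H (∂ F ⊙ G) (F ⊙ ∂ G) m) ⟩
    (((∂ F ⊙ G) ⊙ H) m + ((F ⊙ ∂ G) ⊙ H) m) + ((F ⊙ G) ⊙ ∂ H) m
      ≈⟨ +-assoc _ _ _ ⟩
    ((∂ F ⊙ G) ⊙ H) m + (((F ⊙ ∂ G) ⊙ H) m + ((F ⊙ G) ⊙ ∂ H) m)
      ≈⟨ +-cong (⊙-assoc (∂ F) G H m) (+-cong (⊙-assoc F (∂ G) H m) (⊙-assoc F G (∂ H) m)) ⟩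
    (∂ F ⊙ (G ⊙ H)) m + ((F ⊙ (∂ G ⊙ H)) m + (F ⊙ (G ⊙ ∂ H)) m)
      ≈⟨ +-congˡ (⊙-distribˡ F (∂ G ⊙ H) (G ⊙ ∂ H) m) ⟨
    (∂ F ⊙ (G ⊙ H)) m + (F ⊙ ((∂ G ⊙ H) ⊞ (G ⊙ ∂ H))) m  ∎

  const : Carrier → Series R
  const = constS R

  0S : Series R
  0S _ = 0#

  ⊙-zeroˡ : ∀ F → 0S ⊙ F ≋ 0S
  ⊙-zeroˡ F zero    = zeroˡ _
  ⊙-zeroˡ F (suc m) = trans (+-cong (⊙-zeroˡ F m) (⊙-zeroˡ (∂ F) m)) (+-identityʳ 0#)

  const-⊙ : ∀ a F m → (const a ⊙ F) m ≈ a * F m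
  const-⊙ a F zero    = refl
  const-⊙ a F (suc m) = trans (+-cong (⊙-zeroˡ F m) (const-⊙ a (∂ F) m)) (+-identityˡ _)

  const-* : ∀ a b → const (a * b) ≋ const a ⊙ const b
  const-* a b zero    = refl
  const-* a b (suc m) = sym (trans (const-⊙ a (const b) (suc m)) (zeroʳ a))

  const-+ : ∀ a b → const (a + b) ≋ const a ⊞ const b
  const-+ a b zero    = refl
  const-+ a b (suc m) = sym (+-identityʳ 0#)

  const-cong : ∀ {a b} → a ≈ b → const a ≋ const b
  const-cong p zero    = p
  const-cong p (suc m) = refl

  ⊙-identityˡ : ∀ F → const 1# ⊙ F ≋ F
  ⊙-identityˡ F m = trans (const-⊙ 1# F m) (*-identityˡ _)

  seriesRing : CommutativeRing c ℓ
  seriesRing = record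
    { Carrier = Series R
    ; _≈_ = _≋_
    ; _+_ = _⊞_
    ; _*_ = _⊙_
    ; -_ = λ F m → - F m
    ; 0# = 0S
    ; 1# = const 1#
    ; isCommutativeRing = record
      { isRing = record
        { +-isAbelianGroup = record
          { isGroup = record
            { isMonoid = record
              { isSemigroup = record
                { isMagma = record
                  { isEquivalence = record
                    { refl = λ _ → refl
                    ; sym = λ p m → sym (p m)
                    ; trans = λ p q m → trans (p m) (q m)
                    }
                  ; ∙-cong = λ p q m → +-cong (p m) (q m)
                  }
                ; assoc = λ F G H m → +-assoc _ _ _
                }
              ; identity = (λ F m → +-identityˡ _) , (λ F m → +-identityʳ _)
              }
            ; inverse = (λ F m → -‿inverseˡ _) , (λ F m → -‿inverseʳ _)
            ; ⁻¹-cong = λ p m → -‿cong (p m)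
            }
          ; comm = λ F G m → +-comm _ _
          }
        ; *-cong = ⊙-cong
        ; *-assoc = ⊙-assoc
        ; *-identity = ⊙-identityˡ , (λ F m → trans (⊙-comm F _ m) (⊙-identityˡ F m))
        ; distrib = ⊙-distribˡ , ⊙-distribʳ
        }
      ; *-comm = ⊙-comm
      }
    }

  private
    natR-+ : ∀ a b → natR R (a ℕ.+ b) ≈ natR R a + natR R b
    natR-+ zero    b = sym (+-identityˡ _)
    natR-+ (suc a) b = trans (+-congˡ (natR-+ a b)) (sym (+-assoc _ _ _))

    binomialSum : Series R → Series R → Series R
    binomialSum F G m = Σ< (suc m) (λ k → natR R (m C k) * (F k * G (m ∸ k)))

    -- Pascal's rule splits every term but the first in two, which turns the binomial convolution
    -- into the Leibniz recursion defining `_⊙_`.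
    binomialSum-∂ : ∀ F G m → binomialSum F G (suc m) ≈ binomialSum (∂ F) G m + binomialSum F (∂ G) m
    binomialSum-∂ F G m = begin
      Σ< (suc (suc m)) (λ k → natR R (suc m C k) * (F k * G (suc m ∸ k)))
        ≈⟨ Σ<-suc (suc m) _ ⟩
      t₀ + Σ< (suc m) (λ k → natR R (suc m C suc k) * (F (suc k) * G (m ∸ k)))
        ≈⟨ +-congˡ (Σ<-cong (suc m) (λ {k} _ → pascal k)) ⟩
      t₀ + Σ< (suc m) (λ k → p k + q k)
        ≈⟨ +-congˡ (Σ<-+ (suc m) p q) ⟩
      t₀ + (Σ< (suc m) p + Σ< (suc m) q)
        ≈⟨ solve 3 (λ a b c → a :+ (b :+ c) := b :+ (a :+ c)) refl _ _ _ ⟩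
      Σ< (suc m) p + (t₀ + Σ< (suc m) q)
        -- `t₀` is the term of index 0 of `r`, as m C 0 = 1. The sum of `r` then runs one place too
        -- far, but its last term vanishes because m C (m+1) = 0.
        ≈⟨ +-congˡ (Σ<-suc (suc m) r) ⟨
      Σ< (suc m) p + (Σ< (suc m) r + r (suc m))
        ≈⟨ +-congˡ (+-cong
             (Σ<-cong (suc m) (λ { (s≤s k≤m) → *-congˡ (*-congˡ (reflexive (≡.cong G (ℕₚ.+-∸-assoc 1 k≤m)))) }))
             r-top) ⟩
      Σ< (suc m) p + (binomialSum F (∂ G) m + 0#)
        ≈⟨ +-congˡ (+-identityʳ _) ⟩
      binomialSum (∂ F) G m + binomialSum F (∂ G) m ∎
      where
      t₀ = natR R 1 * (F 0 * G (suc m))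
      p q r : Series R
      p k = natR R (m C k) * (F (suc k) * G (m ∸ k))
      q k = natR R (m C suc k) * (F (suc k) * G (m ∸ k))
      r k = natR R (m C k) * (F k * G (suc m ∸ k))
      pascal : ∀ k → natR R (suc m C suc k) * (F (suc k) * G (m ∸ k)) ≈ p k + q k
      pascal k = trans (*-congʳ (trans (reflexive (≡.cong (natR R) (≡.sym (nCk+nC[k+1]≡[n+1]C[k+1] m k))))
                                       (natR-+ (m C k) (m C suc k))))
                       (distribʳ _ _ _)
      r-top : r (suc m) ≈ 0#
      r-top = trans (*-congʳ (reflexive (≡.cong (natR R) (k>n⇒nCk≡0 {m} {suc m} ℕₚ.≤-refl)))) (zeroˡ _)

    binomialSum≋⊙ : ∀ F G → binomialSum F G ≋ F ⊙ G
    binomialSum≋⊙ F G zero = trans (+-identityˡ _) (trans (*-congʳ (+-identityʳ 1#)) (*-identityˡ _))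
    binomialSum≋⊙ F G (suc m) =
      trans (binomialSum-∂ F G m) (+-cong (binomialSum≋⊙ (∂ F) G m) (binomialSum≋⊙ F (∂ G) m))

  ⊛≋⊙ : ∀ F G → _⊛_ R F G ≋ F ⊙ G
  ⊛≋⊙ F G m = trans (sumR-applyUpTo _ (λ k → k) (suc m)) (binomialSum≋⊙ F G m)

  -- Even and odd parts of a series.

  evenPart oddPart : Series R → Series R
  evenPart F zero    = F 0
  evenPart F (suc m) = oddPart (∂ F) m
  oddPart F zero    = 0#
  oddPart F (suc m) = evenPart (∂ F) m

  mutual
    evenPart-cong : ∀ {F G} → F ≋ G → evenPart F ≋ evenPart G
    evenPart-cong p zero    = p 0
    evenPart-cong p (suc m) = oddPart-cong (p ∘ suc) m

    oddPart-cong : ∀ {F G} → F ≋ G → oddPart F ≋ oddPart G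
    oddPart-cong p zero    = refl
    oddPart-cong p (suc m) = evenPart-cong (p ∘ suc) m

  mutual
    evenPart-⊞ : ∀ F G → evenPart (F ⊞ G) ≋ evenPart F ⊞ evenPart G
    evenPart-⊞ F G zero    = refl
    evenPart-⊞ F G (suc m) = oddPart-⊞ (∂ F) (∂ G) m

    oddPart-⊞ : ∀ F G → oddPart (F ⊞ G) ≋ oddPart F ⊞ oddPart G
    oddPart-⊞ F G zero    = sym (+-identityʳ 0#)
    oddPart-⊞ F G (suc m) = evenPart-⊞ (∂ F) (∂ G) m

  IsEven IsOdd : Series R → Set ℓ
  IsEven F = oddPart F ≋ 0S
  IsOdd F = evenPart F ≋ 0S

  mutual
    -- Differentiation exchanges even and odd series, so under the Leibniz rule the statements for
    -- an even and for an odd first factor call each other; the four are proved together.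
    evenPart-⊙ : ∀ F G → IsEven F → evenPart (F ⊙ G) ≋ F ⊙ evenPart G
    evenPart-⊙ F G Fe zero    = refl
    evenPart-⊙ F G Fe (suc m) =
      trans (oddPart-⊞ (∂ F ⊙ G) (F ⊙ ∂ G) m)
            (+-cong (oddPart-⊙-odd (∂ F) G (Fe ∘ suc) m) (oddPart-⊙ F (∂ G) Fe m))

    oddPart-⊙ : ∀ F G → IsEven F → oddPart (F ⊙ G) ≋ F ⊙ oddPart G
    oddPart-⊙ F G Fe zero    = sym (zeroʳ _)
    oddPart-⊙ F G Fe (suc m) =
      trans (evenPart-⊞ (∂ F ⊙ G) (F ⊙ ∂ G) m)
            (+-cong (evenPart-⊙-odd (∂ F) G (Fe ∘ suc) m) (evenPart-⊙ F (∂ G) Fe m))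

    oddPart-⊙-odd : ∀ F G → IsOdd F → oddPart (F ⊙ G) ≋ F ⊙ evenPart G
    oddPart-⊙-odd F G Fo zero    = sym (trans (*-congʳ (Fo 0)) (zeroˡ _))
    oddPart-⊙-odd F G Fo (suc m) =
      trans (evenPart-⊞ (∂ F ⊙ G) (F ⊙ ∂ G) m)
            (+-cong (evenPart-⊙ (∂ F) G (Fo ∘ suc) m) (evenPart-⊙-odd F (∂ G) Fo m))

    evenPart-⊙-odd : ∀ F G → IsOdd F → evenPart (F ⊙ G) ≋ F ⊙ oddPart G
    evenPart-⊙-odd F G Fo zero    = trans (trans (*-congʳ (Fo 0)) (zeroˡ _)) (sym (zeroʳ _))
    evenPart-⊙-odd F G Fo (suc m) =
      trans (oddPart-⊞ (∂ F ⊙ G) (F ⊙ ∂ G) m)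
            (+-cong (oddPart-⊙ (∂ F) G (Fo ∘ suc) m) (oddPart-⊙-odd F (∂ G) Fo m))

  evenS≋evenPart : ∀ {f} F → (∀ k → f k ≈ F (2 ℕ.* k)) → evenS R f ≋ evenPart F
  evenS≋evenPart F h zero          = h 0
  evenS≋evenPart F h (suc zero)    = refl
  evenS≋evenPart F h (suc (suc m)) = evenS≋evenPart (∂ (∂ F))
    (λ k → trans (h (suc k)) (reflexive (≡.cong F (ℕₚ.*-suc 2 k)))) m

  evenPart-evenS : ∀ f → evenPart (evenS R f) ≋ evenS R f
  evenPart-evenS f zero          = refl
  evenPart-evenS f (suc zero)    = refl
  evenPart-evenS f (suc (suc m)) = evenPart-evenS (f ∘ suc) m

  oddPart-evenS : ∀ f → oddPart (evenS R f) ≋ 0S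
  oddPart-evenS f zero          = refl
  oddPart-evenS f (suc zero)    = refl
  oddPart-evenS f (suc (suc m)) = oddPart-evenS (f ∘ suc) m

  evenPart-oddS : ∀ f → evenPart (oddS R f) ≋ 0S
  evenPart-oddS f zero    = refl
  evenPart-oddS f (suc m) = oddPart-evenS f m

  oddPart-oddS : ∀ f → oddPart (oddS R f) ≋ oddS R f
  oddPart-oddS f zero    = refl
  oddPart-oddS f (suc m) = evenPart-evenS f m

  mutual
    evenPart-* : ∀ a F → evenPart (λ m → a * F m) ≋ (λ m → a * evenPart F m)
    evenPart-* a F zero    = refl
    evenPart-* a F (suc m) = oddPart-* a (∂ F) m

    oddPart-* : ∀ a F → oddPart (λ m → a * F m) ≋ (λ m → a * oddPart F m)
    oddPart-* a F zero    = sym (zeroʳ a)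
    oddPart-* a F (suc m) = evenPart-* a (∂ F) m

  mutual
    evenPart-0S : evenPart 0S ≋ 0S
    evenPart-0S zero    = refl
    evenPart-0S (suc m) = oddPart-0S m

    oddPart-0S : oddPart 0S ≋ 0S
    oddPart-0S zero    = refl
    oddPart-0S (suc m) = evenPart-0S m

  const-isEven : ∀ a → IsEven (const a)
  const-isEven a zero    = refl
  const-isEven a (suc m) = evenPart-0S m

-- Hyperbolic functions as formal series.

module Hyperbolic {c ℓ} (R : CommutativeRing c ℓ) (α : CommutativeRing.Carrier R) where
  open CommutativeRing R
  open ExponentialSeries R
  open SetoidReasoning setoid
  open SemiringSolver commutativeSemiring using (solve; _:=_; _:+_; _:*_; con)

  -- With β² = α these are cosh (β t), sinh (β t) / β and (cosh (β t) - 1) / α.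
  cosh sinh versh : Series R
  cosh = evenS R (pow R α)
  sinh = oddS R (pow R α)
  versh zero    = 0#
  versh (suc m) = sinh m

  evenS-* : ∀ a f → evenS R (λ n → a * f n) ≋ (λ m → a * evenS R f m)
  evenS-* a f zero          = refl
  evenS-* a f (suc zero)    = sym (zeroʳ a)
  evenS-* a f (suc (suc m)) = evenS-* a (f ∘ suc) m

  ∂cosh : ∀ m → ∂ cosh m ≈ α * sinh m
  ∂cosh zero    = sym (zeroʳ α)
  ∂cosh (suc m) = evenS-* α (pow R α) m

  cosh≋1+αversh : ∀ m → cosh m ≈ const 1# m + α * versh m
  cosh≋1+αversh zero    = sym (trans (+-congˡ (zeroʳ α)) (+-identityʳ 1#))
  cosh≋1+αversh (suc m) = trans (∂cosh m) (sym (+-identityˡ _))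

  ⊙-scaleʳ : ∀ a F G m → (F ⊙ (λ k → a * G k)) m ≈ a * (F ⊙ G) m
  ⊙-scaleʳ a F G zero    = solve 3 (λ a f g → f :* (a :* g) := a :* (f :* g)) refl _ _ _
  ⊙-scaleʳ a F G (suc m) =
    trans (+-cong (⊙-scaleʳ a (∂ F) G m) (⊙-scaleʳ a F (∂ G) m)) (sym (distribˡ a _ _))

  ⊙-scaleˡ : ∀ a F G m → ((λ k → a * F k) ⊙ G) m ≈ a * (F ⊙ G) m
  ⊙-scaleˡ a F G m =
    trans (⊙-comm _ G m) (trans (⊙-scaleʳ a G F m) (*-congˡ (⊙-comm G F m)))

  cosh-⊙ : ∀ F m → (cosh ⊙ F) m ≈ F m + α * (versh ⊙ F) m
  cosh-⊙ F m = begin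
    (cosh ⊙ F) m
      ≈⟨ ⊙-cong cosh≋1+αversh (λ _ → refl) m ⟩
    ((const 1# ⊞ (λ k → α * versh k)) ⊙ F) m
      ≈⟨ ⊙-distribʳ F (const 1#) (λ k → α * versh k) m ⟩
    (const 1# ⊙ F) m + ((λ k → α * versh k) ⊙ F) m
      ≈⟨ +-cong (⊙-identityˡ F m) (⊙-scaleˡ α versh F m) ⟩
    F m + α * (versh ⊙ F) m ∎

  -- The hypothesis on w says w(·, j) = (∂ + d)ʲ w(·, 0), where d also flips the
  -- Boolean; since ∂ + d is ∂ conjugated by exp (d t), the diagonal values are
  -- coefficients of exp (d t) w(·, 0), and u is (exp (d t) - 1) / d applied to w.
  diagonal : (d : Bool → Carrier) → (∀ e → α ≈ d e * d (not e)) →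
    (w u : Bool → ℕ → ℕ → Carrier) →
    (∀ e i j → w e i (suc j) ≈ w e (suc i) j + d e * w (not e) i j) →
    (∀ e i j → u e i (suc j) ≈ u e (suc i) j + w (not e) i j) →
    ∀ e j → u e 0 j ≈ u e j 0 + ((sinh ⊙ (λ i → w (not e) i 0)) j
                                + d (not e) * (versh ⊙ (λ i → w e i 0)) j)
  diagonal d α≈ w u hw hu e zero = sym (begin
    u e 0 0 + (0# * w (not e) 0 0 + d (not e) * (0# * w e 0 0))
      ≈⟨ solve 4 (λ a b c d → a :+ (con 0 :* b :+ c :* (con 0 :* d)) := a) refl _ _ _ _ ⟩
    u e 0 0 ∎)
  diagonal d α≈ w u hw hu e (suc j) = begin
    u e 0 (suc j)
      -- The families vary in the induction: shifting the second index of `w` and `u` preserves both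
      -- recurrences.
      ≈⟨ diagonal d α≈ (λ e i j → w e i (suc j)) (λ e i j → u e i (suc j))
           (λ e i j → hw e i (suc j)) (λ e i j → hu e i (suc j)) e j ⟩
    u e j 1 + ((sinh ⊙ (λ i → w (not e) i 1)) j + d′ * (versh ⊙ (λ i → w e i 1)) j)
      ≈⟨ +-cong (hu e j 0) (+-cong
           (⊙-cong (λ _ → refl) W′-step j)
           (*-congˡ (⊙-cong (λ _ → refl) (λ i → hw e i 0) j))) ⟩
    (u e (suc j) 0 + W′ j) + ((sinh ⊙ (∂ W′ ⊞ (λ i → d′ * W i))) j
                             + d′ * (versh ⊙ (∂ W ⊞ (λ i → d e * W′ i))) j)
      ≈⟨ +-congˡ (+-cong
           (trans (⊙-distribˡ sinh (∂ W′) _ j) (+-congˡ (⊙-scaleʳ d′ sinh W j)))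
           (*-congˡ (trans (⊙-distribˡ versh (∂ W) _ j) (+-congˡ (⊙-scaleʳ (d e) versh W′ j))))) ⟩
    (u e (suc j) 0 + W′ j) + (((sinh ⊙ ∂ W′) j + d′ * (sinh ⊙ W) j)
                             + d′ * ((versh ⊙ ∂ W) j + d e * (versh ⊙ W′) j))
      ≈⟨ solve 8 (λ u w′ s′ d′ s v d v′ →
           (u :+ w′) :+ ((s′ :+ d′ :* s) :+ d′ :* (v :+ d :* v′))
           := u :+ (((w′ :+ (d :* d′) :* v′) :+ s′) :+ d′ :* (s :+ v))) refl _ _ _ _ _ _ _ _ ⟩
    u e (suc j) 0 + (((W′ j + (d e * d′) * (versh ⊙ W′) j) + (sinh ⊙ ∂ W′) j)
                    + d′ * ((sinh ⊙ W) j + (versh ⊙ ∂ W) j))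
      -- Since `d e * d′` is α, `W′` and its `versh` term combine to `cosh ⊙ W′`. As `∂ sinh` is
      -- `cosh` and `∂ versh` is `sinh`, the result is the Leibniz expansion of both products at
      -- `suc j`.
      ≈⟨ +-congˡ (+-congʳ (+-congʳ (trans (+-congˡ (*-congʳ (sym (α≈ e)))) (sym (cosh-⊙ W′ j))))) ⟩
    u e (suc j) 0 + (((cosh ⊙ W′) j + (sinh ⊙ ∂ W′) j)
                    + d′ * ((sinh ⊙ W) j + (versh ⊙ ∂ W) j)) ∎
    where
    d′ = d (not e)
    W W′ : Series R
    W i = w e i 0
    W′ i = w (not e) i 0
    W′-step : ∀ i → w (not e) i 1 ≈ W′ (suc i) + d′ * W i
    W′-step i = trans (hw (not e) i 0)
      (+-congˡ (*-congˡ (reflexive (≡.cong (λ b → w b i 0) (not-involutive e)))))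

  evenS-cong : ∀ {f g : ℕ → Carrier} → (∀ n → f n ≈ g n) → evenS R f ≋ evenS R g
  evenS-cong p zero          = p 0
  evenS-cong p (suc zero)    = refl
  evenS-cong p (suc (suc m)) = evenS-cong (p ∘ suc) m

  ⊙-∂cosh : ∀ F m → (F ⊙ ∂ cosh) m ≈ α * (F ⊙ sinh) m
  ⊙-∂cosh F m = trans (⊙-cong (λ _ → refl) ∂cosh m) (⊙-scaleʳ α F sinh m)

  -- Both sides have constant term 1 and derivative 2 α `cosh ⊙ sinh`; in exponential form these
  -- data determine a series over any ring.
  cosh² : cosh ⊙ cosh ≋ const 1# ⊞ const α ⊙ (sinh ⊙ sinh)
  cosh² m = trans (go m) (+-congˡ (sym (const-⊙ α (sinh ⊙ sinh) m)))
    where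
    go : ∀ m → (cosh ⊙ cosh) m ≈ const 1# m + α * (sinh ⊙ sinh) m
    go zero    = solve 1 (λ a → con 1 :* con 1 := con 1 :+ a :* (con 0 :* con 0)) refl _
    go (suc m) = begin
      (∂ cosh ⊙ cosh) m + (cosh ⊙ ∂ cosh) m
        ≈⟨ +-congʳ (⊙-comm (∂ cosh) cosh m) ⟩
      (cosh ⊙ ∂ cosh) m + (cosh ⊙ ∂ cosh) m
        ≈⟨ +-cong (⊙-∂cosh cosh m) (⊙-∂cosh cosh m) ⟩
      α * (cosh ⊙ sinh) m + α * (cosh ⊙ sinh) m
        ≈⟨ solve 2 (λ a s → a :* s :+ a :* s := con 0 :+ a :* (s :+ s)) refl _ _ ⟩
      0# + α * ((cosh ⊙ sinh) m + (cosh ⊙ sinh) m)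
        ≈⟨ +-congˡ (*-congˡ (+-congˡ (⊙-comm cosh sinh m))) ⟩
      0# + α * ((cosh ⊙ sinh) m + (sinh ⊙ cosh) m) ∎

  cosh₂ : Series R
  cosh₂ = evenS R (λ n → pow R α n * pow R (1# + 1#) (2 ℕ.* n))

  -- Both sides solve F″ = 4 α F with F(0) = 1 and F′(0) = 0. For the right-hand side, `cosh²` gives
  -- (sinh²)″ = 2 (1 + 2 α sinh²).
  cosh₂-duplication : cosh₂ ≋ const 1# ⊞ const (α + α) ⊙ (sinh ⊙ sinh)
  cosh₂-duplication m = trans (go m) (+-congˡ (sym (const-⊙ (α + α) (sinh ⊙ sinh) m)))
    where
    four : Carrier
    four = (1# + 1#) * (1# + 1#)

    coeff : ∀ n → pow R α (suc n) * pow R (1# + 1#) (2 ℕ.* suc n)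
                  ≈ (α * four) * (pow R α n * pow R (1# + 1#) (2 ℕ.* n))
    coeff n = trans (*-congˡ (reflexive (≡.cong (pow R (1# + 1#)) (ℕₚ.*-suc 2 n))))
      (solve 3 (λ a p q → (a :* p) :* ((con 1 :+ con 1) :* ((con 1 :+ con 1) :* q))
                     := (a :* ((con 1 :+ con 1) :* (con 1 :+ con 1))) :* (p :* q)) refl _ _ _)

    sinh²-∂∂ : ∀ m → ∂ (∂ (sinh ⊙ sinh)) m ≈ (1# + 1#) * (const 1# m + (α + α) * (sinh ⊙ sinh) m)
    sinh²-∂∂ m = begin
      ((∂ cosh ⊙ sinh) m + (cosh ⊙ cosh) m) + ((cosh ⊙ cosh) m + (sinh ⊙ ∂ cosh) m)
        ≈⟨ +-cong (+-cong (trans (⊙-comm (∂ cosh) sinh m) (⊙-∂cosh sinh m)) cc) (+-cong cc (⊙-∂cosh sinh m)) ⟩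
      (α * ss + (const 1# m + α * ss)) + ((const 1# m + α * ss) + α * ss)
        ≈⟨ solve 3 (λ a s k → (a :* s :+ (k :+ a :* s)) :+ ((k :+ a :* s) :+ a :* s)
                       := (con 1 :+ con 1) :* (k :+ (a :+ a) :* s)) refl _ _ _ ⟩
      (1# + 1#) * (const 1# m + (α + α) * ss) ∎
      where
      ss = (sinh ⊙ sinh) m
      cc = trans (cosh² m) (+-congˡ (const-⊙ α (sinh ⊙ sinh) m))

    go : ∀ m → cosh₂ m ≈ const 1# m + (α + α) * (sinh ⊙ sinh) m
    go zero       = solve 1 (λ a → con 1 :* con 1 := con 1 :+ a :* (con 0 :* con 0)) refl _
    go (suc zero) = solve 1 (λ a → con 0 := con 0 :+ a :* (con 1 :* con 0 :+ con 0 :* con 1)) refl _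
    go (suc (suc m)) = begin
      cosh₂ (suc (suc m))
        ≈⟨ evenS-cong coeff m ⟩
      evenS R (λ n → (α * four) * (pow R α n * pow R (1# + 1#) (2 ℕ.* n))) m
        ≈⟨ evenS-* (α * four) _ m ⟩
      (α * four) * cosh₂ m
        ≈⟨ *-congˡ (go m) ⟩
      (α * four) * (const 1# m + (α + α) * (sinh ⊙ sinh) m)
        ≈⟨ solve 2 (λ a t → (a :* ((con 1 :+ con 1) :* (con 1 :+ con 1))) :* t
                       := con 0 :+ (a :+ a) :* ((con 1 :+ con 1) :* t)) refl _ _ ⟩
      0# + (α + α) * ((1# + 1#) * (const 1# m + (α + α) * (sinh ⊙ sinh) m))
        ≈⟨ +-congˡ (*-congˡ (sinh²-∂∂ m)) ⟨
      0# + (α + α) * (sinh ⊙ sinh) (suc (suc m)) ∎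

-- The recursion on ranks and its functional equations.

module RankRecursion {c ℓ} (R : CommutativeRing c ℓ)
  (z : Bool → Bool → CommutativeRing.Carrier R) where
  open CommutativeRing R
  open FiniteSums R
  open ExponentialSeries R
  open SetoidReasoning setoid
  open SemiringSolver commutativeSemiring using (solve; _:=_; _:+_; _:*_; con)

  -- Total weight of the continuations of a word whose last letter has sign s
  -- (true for +), when r absolute values are unused and j of them are smaller
  -- than that of the last letter; e tells whether the current position is even.
  -- Here z true and z false are the weights of ascents and descents; changing all
  -- signs exchanges the two, whence z (not s).
  completions : Bool → ℕ → ℕ → Bool → Carrier
  completions s zero    j e = 1#
  completions s (suc r) j e = Σ< (suc r) (λ i →
    z (not s) e * completions (not s) r i (not e)
    + (if i <ᵇ j then z (not s) e else z s e) * completions s r i (not e))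

  d : Bool → Bool → Carrier
  d s e = z (not s) e - z s e

  total : Bool → ℕ → Bool → Carrier
  total s r e = Σ< (suc r) (λ i → completions s r i (not e))

  Z : Bool → Series R
  Z e r = completions true r 0 e

  z-not : ∀ s e → z (not s) e ≈ z s e + d s e
  z-not s e = sym (begin
    z s e + (z (not s) e - z s e)     ≈⟨ solve 3 (λ a b c → a :+ (b :+ c) := b :+ (a :+ c)) refl _ _ _ ⟩
    z (not s) e + (z s e - z s e)     ≈⟨ +-congˡ (-‿inverseʳ _) ⟩
    z (not s) e + 0#                  ≈⟨ +-identityʳ _ ⟩
    z (not s) e                       ∎)

  -- The branch `y` contributes an extra `δ` on exactly the first `j` terms.
  Σ<-threshold : ∀ {x y δ} → y ≈ x + δ → ∀ g {n j} → j ℕ.≤ n →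
    Σ< n (λ i → (if i <ᵇ j then y else x) * g i) ≈ x * Σ< n g + δ * Σ< j g
  Σ<-threshold {x} {y} {δ} y≈ g {n} z≤n = trans (Σ<-* n x g) (sym (trans (+-congˡ (zeroʳ δ)) (+-identityʳ _)))
  Σ<-threshold {x} {y} {δ} y≈ g {suc n} {suc j} (s≤s j≤n) = begin
    Σ< (suc n) (λ i → (if i <ᵇ suc j then y else x) * g i)
      ≈⟨ Σ<-suc n _ ⟩
    y * g 0 + Σ< n (λ i → (if i <ᵇ j then y else x) * g (suc i))
      ≈⟨ +-cong (*-congʳ y≈) (Σ<-threshold y≈ (g ∘ suc) j≤n) ⟩
    (x + δ) * g 0 + (x * Σ< n (g ∘ suc) + δ * Σ< j (g ∘ suc))
      ≈⟨ solve 5 (λ x δ g a b → (x :+ δ) :* g :+ (x :* a :+ δ :* b)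
                              := x :* (g :+ a) :+ δ :* (g :+ b)) refl _ _ _ _ _ ⟩
    x * (g 0 + Σ< n (g ∘ suc)) + δ * (g 0 + Σ< j (g ∘ suc))
      ≈⟨ +-cong (*-congˡ (Σ<-suc n g)) (*-congˡ (Σ<-suc j g)) ⟨
    x * Σ< (suc n) g + δ * Σ< (suc j) g ∎

  -- Isolates the dependence on `j`: only next letters of the same sign and smaller absolute value
  -- see it, and each has its weight changed by `d s e`.
  completions-suc : ∀ s r {j} e → j ℕ.≤ suc r → completions s (suc r) j e ≈
    (z (not s) e * total (not s) r e + z s e * total s r e)
    + d s e * Σ< j (λ i → completions s r i (not e))
  completions-suc s r e j≤ = trans (Σ<-+ (suc r) _ _) (trans
    (+-cong (Σ<-* (suc r) (z (not s) e) _) (Σ<-threshold (z-not s e) _ j≤)) (sym (+-assoc _ _ _)))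

  completions-0 : ∀ s r e → completions s (suc r) 0 e ≈
    z (not s) e * total (not s) r e + z s e * total s r e
  completions-0 s r e = trans (completions-suc s r e z≤n)
    (trans (+-congˡ (zeroʳ _)) (+-identityʳ _))

  -- At `j = 0` the sum over next letters is unchanged, up to order, when the two signs are
  -- exchanged.
  completions-0≈Z : ∀ s r e → completions s r 0 e ≈ Z e r
  completions-0≈Z true  r       e = refl
  completions-0≈Z false zero    e = refl
  completions-0≈Z false (suc r) e =
    trans (completions-0 false r e) (trans (+-comm _ _) (sym (completions-0 true r e)))

  -- `pred` lets the formula include `r = 0`, where `j` is 0 and the sum is empty.
  completions-Z : ∀ s r {j} e → j ℕ.≤ r → completions s r j e ≈
    Z e r + d s e * Σ< j (λ i → completions s (pred r) i (not e))
  completions-Z s zero    e z≤n = sym (trans (+-congˡ (zeroʳ _)) (+-identityʳ _))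
  completions-Z s (suc r) e j≤r =
    trans (completions-suc s r e j≤r)
          (+-congʳ (trans (sym (completions-0 s r e)) (completions-0≈Z s (suc r) e)))

  -- This makes `d false e` the negative of `d true e`, in additive form because the solver works
  -- over semirings.
  d-false : ∀ e → d true e + d false e ≈ 0#
  d-false e = begin
    (z false e - z true e) + (z true e - z false e)
      ≈⟨ solve 4 (λ a b c d → (a :+ b) :+ (c :+ d) := (a :+ d) :+ (c :+ b)) refl _ _ _ _ ⟩
    (z false e - z false e) + (z true e - z true e)
      ≈⟨ +-cong (-‿inverseʳ _) (-‿inverseʳ _) ⟩
    0# + 0#
      ≈⟨ +-identityʳ 0# ⟩
    0# ∎

  module _ (α : Carrier) (α≈ : α ≈ d true true * d true false) where
    open Hyperbolic R α

    α≈dd⁺ : ∀ e → α ≈ d true e * d true (not e)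
    α≈dd⁺ true  = α≈
    α≈dd⁺ false = trans α≈ (*-comm _ _)

    α≈dd : ∀ s e → α ≈ d s e * d s (not e)
    α≈dd true  e = α≈dd⁺ e
    α≈dd false e = trans (α≈dd⁺ e) (begin
      d true e * d true (not e)
        -- A product of two negatives: one vanishing multiple of `d true + d false` is added, and
        -- after regrouping another is dropped.
        ≈⟨ trans (+-congˡ (trans (*-congʳ (d-false e)) (zeroˡ _))) (+-identityʳ _) ⟨
      d true e * d true (not e) + (d true e + d false e) * d false (not e)
        ≈⟨ solve 4 (λ a b a′ b′ → a :* a′ :+ (a :+ b) :* b′ := b :* b′ :+ a :* (a′ :+ b′)) refl _ _ _ _ ⟩
      d false e * d false (not e) + d true e * (d true (not e) + d false (not e))
        ≈⟨ trans (+-congˡ (trans (*-congˡ (d-false (not e))) (zeroʳ _))) (+-identityʳ _) ⟩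
      d false e * d false (not e) ∎)

    completions-step : ∀ s e i j → completions s (i ℕ.+ suc j) (suc j) e ≈
      completions s (suc i ℕ.+ j) j e + d s e * completions s (i ℕ.+ j) j (not e)
    completions-step s e i j = begin
      completions s (i ℕ.+ suc j) (suc j) e
        ≈⟨ reflexive (≡.cong (λ r → completions s r (suc j) e) (ℕₚ.+-suc i j)) ⟩
      completions s (suc (i ℕ.+ j)) (suc j) e
        ≈⟨ completions-Z s _ e (s≤s (ℕₚ.m≤n+m j i)) ⟩
      Z e (suc (i ℕ.+ j)) + d s e * (Σ< j g + g j)
        ≈⟨ trans (+-congˡ (distribˡ _ _ _)) (sym (+-assoc _ _ _)) ⟩
      (Z e (suc (i ℕ.+ j)) + d s e * Σ< j g) + d s e * g j
        ≈⟨ +-congʳ (completions-Z s _ e (ℕₚ.m≤n+m j (suc i))) ⟨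
      completions s (suc i ℕ.+ j) j e + d s e * g j ∎
      where
      g = λ k → completions s (i ℕ.+ j) k (not e)

    total≈ : ∀ s r e → total s r e ≈
      (sinh ⊙ Z (not e)) (suc r) + d s (not e) * (versh ⊙ Z e) (suc r)
    total≈ s r e = begin
      total s r e
        ≈⟨ diagonal (d s) (α≈dd s) (λ e i j → completions s (i ℕ.+ j) j e)
             (λ e i j → Σ< j (λ k → completions s (pred (i ℕ.+ j)) k (not e)))
             (completions-step s) prefix-step e (suc r) ⟩
      0# + ((sinh ⊙ W (not e)) (suc r) + d s (not e) * (versh ⊙ W e) (suc r))
        ≈⟨ +-identityˡ _ ⟩
      (sinh ⊙ W (not e)) (suc r) + d s (not e) * (versh ⊙ W e) (suc r)
        ≈⟨ +-cong (⊙-cong (λ _ → refl) (W≋Z (not e)) (suc r))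
                  (*-congˡ (⊙-cong (λ _ → refl) (W≋Z e) (suc r))) ⟩
      (sinh ⊙ Z (not e)) (suc r) + d s (not e) * (versh ⊙ Z e) (suc r) ∎
      where
      W : Bool → Series R
      W e i = completions s (i ℕ.+ 0) 0 e
      W≋Z : ∀ e → W e ≋ Z e
      W≋Z e i = trans (completions-0≈Z s (i ℕ.+ 0) e) (reflexive (≡.cong (Z e) (ℕₚ.+-identityʳ i)))
      prefix-step : ∀ e i j → Σ< (suc j) (λ k → completions s (pred (i ℕ.+ suc j)) k (not e)) ≈
        Σ< j (λ k → completions s (i ℕ.+ j) k (not e)) + completions s (i ℕ.+ j) j (not e)
      prefix-step e i j = reflexive
        (≡.cong (λ r → Σ< (suc j) (λ k → completions s (pred r) k (not e))) (ℕₚ.+-suc i j))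

    -- In `Z e (suc r)` the two totals contribute `Q` with coefficient -α, because `d false` is the
    -- negative of `d true`. The term α `Q` coming from `cosh-⊙` cancels it, and only the multiple
    -- of `P` survives.
    cosh-Z : ∀ e m → (cosh ⊙ Z e) m ≈ const 1# m + (z true e + z false e) * (sinh ⊙ Z (not e)) m
    cosh-Z e zero = solve 1 (λ a → con 1 :* con 1 := con 1 :+ a :* (con 0 :* con 1)) refl _
    cosh-Z e (suc r) = begin
      (cosh ⊙ Z e) (suc r)
        ≈⟨ cosh-⊙ (Z e) (suc r) ⟩
      Z e (suc r) + α * Q
        ≈⟨ +-cong (trans (completions-0 true r e)
                     (+-cong (*-cong (z-not true e) (total≈ false r e)) (*-congˡ (total≈ true r e))))
                  (*-congʳ (α≈dd true e)) ⟩
      ((x + δ) * (P + d false (not e) * Q) + x * (P + d true (not e) * Q)) + (δ * d true (not e)) * Q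
        ≈⟨ solve 6 (λ x δ P Q d d⁻ →
             ((x :+ δ) :* (P :+ d⁻ :* Q) :+ x :* (P :+ d :* Q)) :+ (δ :* d) :* Q
             := (x :+ (x :+ δ)) :* P :+ ((x :+ δ) :* Q) :* (d :+ d⁻)) refl _ _ _ _ _ _ ⟩
      (x + (x + δ)) * P + ((x + δ) * Q) * (d true (not e) + d false (not e))
        ≈⟨ +-cong (*-congʳ (+-congˡ (sym (z-not true e)))) (trans (*-congˡ (d-false (not e))) (zeroʳ _)) ⟩
      (x + z false e) * P + 0#
        ≈⟨ +-comm _ _ ⟩
      0# + (x + z false e) * P ∎
      where
      x = z true e
      δ = d true e
      P = (sinh ⊙ Z (not e)) (suc r)
      Q = (versh ⊙ Z e) (suc r)

infixl 6 _∖_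
_∖_ : (ℕ → Bool) → ℕ → ℕ → Bool
(av ∖ k) j = if does (k ℕ.≟ j) then false else av j

∖-self : ∀ av k → (av ∖ k) k ≡ false
∖-self av k rewrite dec-true (k ℕ.≟ k) ≡.refl = ≡.refl

∖-other : ∀ av {k j} → k ≢ j → (av ∖ k) j ≡ av j
∖-other av {k} {j} k≢j rewrite dec-false (k ℕ.≟ j) k≢j = ≡.refl

admissible : (ℕ → Bool) → List ℕ → Bool
admissible av []       = true
admissible av (k ∷ ks) = if av k then admissible (av ∖ k) ks else false

All-∖⁻ : ∀ av k ks → All (λ j → (av ∖ k) j ≡ true) ks →
         All (λ j → av j ≡ true) ks × All (k ≢_) ks
All-∖⁻ av k []       []        = [] , []
All-∖⁻ av k (j ∷ ks) (h ∷ hs) with k ℕ.≟ j | All-∖⁻ av k ks hs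
... | yes ≡.refl | _     = contradiction (≡.trans (≡.sym (∖-self av k)) h) λ ()
... | no k≢j     | a , b = ≡.trans (≡.sym (∖-other av k≢j)) h ∷ a , k≢j ∷ b

All-∖⁺ : ∀ av k ks → All (λ j → av j ≡ true) ks → All (k ≢_) ks →
         All (λ j → (av ∖ k) j ≡ true) ks
All-∖⁺ av k []       []       []       = []
All-∖⁺ av k (j ∷ ks) (h ∷ hs) (k≢j ∷ ps) = ≡.trans (∖-other av k≢j) h ∷ All-∖⁺ av k ks hs ps

admissible⇒unique : ∀ av ks → admissible av ks ≡ true → All (λ j → av j ≡ true) ks × Unique ks
admissible⇒unique av []       h = [] , []
admissible⇒unique av (k ∷ ks) h with av k in eq
... | true with admissible⇒unique (av ∖ k) ks h
...   | a , u with All-∖⁻ av k ks a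
...     | a′ , k∉ = eq ∷ a′ , k∉ ∷ u

unique⇒admissible : ∀ av ks → All (λ j → av j ≡ true) ks → Unique ks → admissible av ks ≡ true
unique⇒admissible av []       []       []       = ≡.refl
unique⇒admissible av (k ∷ ks) (h ∷ hs) (k∉ ∷ u) rewrite h =
  unique⇒admissible (av ∖ k) ks (All-∖⁺ av k ks hs k∉) u

does-unique? : ∀ ks → does (UniqueDec.unique? ks) ≡ admissible (λ _ → true) ks
does-unique? ks with admissible (λ _ → true) ks in eq
... | true  = dec-true (UniqueDec.unique? ks) (proj₂ (admissible⇒unique _ ks eq))
... | false = dec-false (UniqueDec.unique? ks)
  (λ u → contradiction
    (≡.trans (≡.sym eq) (unique⇒admissible _ ks (All.universal (λ _ → ≡.refl) ks) u)) λ ())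

-- Letters of absolute value suc i are indexed by i.
rank : (ℕ → Bool) → ℕ → ℕ
rank av zero    = 0
rank av (suc k) = if av (suc k) then suc (rank av k) else rank av k

rank-full : ∀ n → rank (λ _ → true) n ≡ n
rank-full zero    = ≡.refl
rank-full (suc n) = ≡.cong suc (rank-full n)

rank-step : ∀ av k → rank av k ℕ.≤ rank av (suc k)
rank-step av k with av (suc k)
... | true  = ℕₚ.n≤1+n _
... | false = ℕₚ.≤-refl

rank-mono : ∀ av {j k} → j ℕ.≤ k → rank av j ℕ.≤ rank av k
rank-mono av {k = zero}  z≤n = z≤n
rank-mono av {k = suc k} j≤1+k with ℕₚ.m≤n⇒m<n∨m≡n j≤1+k
... | inj₁ (s≤s j≤k) = ℕₚ.≤-trans (rank-mono av j≤k) (rank-step av k)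
... | inj₂ ≡.refl    = ℕₚ.≤-refl

rank-strict : ∀ av {j k} → av (suc j) ≡ true → j ℕ.< k → rank av j ℕ.< rank av k
rank-strict av {j} {k} h j<k = ℕₚ.≤-trans (ℕₚ.≤-reflexive lemma) (rank-mono av j<k)
  where
  lemma : suc (rank av j) ≡ rank av (suc j)
  lemma rewrite h = ≡.refl

-- A free value below that of `k` is counted in `rank av k` but not in its own rank. Freeness is
-- asked of `j` alone: `k` will index the current letter, whose value is already used.
rank-<ᵇ : ∀ av {j} k → av (suc j) ≡ true → (rank av j <ᵇ rank av k) ≡ (j <ᵇ k)
rank-<ᵇ av {j} k h with j ℕ.<? k
... | yes j<k = ≡.trans (dec-true (rank av j ℕ.<? rank av k) (rank-strict av h j<k))
                        (≡.sym (dec-true (j ℕ.<? k) j<k))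
... | no  j≮k = ≡.trans (dec-false (rank av j ℕ.<? rank av k) (ℕₚ.≤⇒≯ (rank-mono av (ℕₚ.≮⇒≥ j≮k))))
                        (≡.sym (dec-false (j ℕ.<? k) j≮k))

<ᵇ-flip : ∀ {j k} → j ≢ k → (k <ᵇ j) ≡ not (j <ᵇ k)
<ᵇ-flip {zero}  {zero}  j≢k = contradiction ≡.refl j≢k
<ᵇ-flip {zero}  {suc k} j≢k = ≡.refl
<ᵇ-flip {suc j} {zero}  j≢k = ≡.refl
<ᵇ-flip {suc j} {suc k} j≢k = <ᵇ-flip (j≢k ∘ ≡.cong suc)

rank-∖-below : ∀ av k j → j ℕ.≤ k → rank (av ∖ suc k) j ≡ rank av j
rank-∖-below av k zero    j≤k = ≡.refl
rank-∖-below av k (suc j) j<k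
  rewrite ∖-other av (ℕₚ.>⇒≢ (s≤s j<k)) | rank-∖-below av k j (ℕₚ.<⇒≤ j<k) = ≡.refl

rank-∖-above : ∀ av k j → av (suc k) ≡ true → k ℕ.< j → rank av j ≡ suc (rank (av ∖ suc k) j)
rank-∖-above av k (suc j) h (s≤s k≤j) with ℕₚ.m≤n⇒m<n∨m≡n k≤j
... | inj₂ ≡.refl
  rewrite ∖-self av (suc k) | h | rank-∖-below av k k ℕₚ.≤-refl = ≡.refl
... | inj₁ k<j
  rewrite ∖-other av (ℕₚ.<⇒≢ (s≤s k<j)) | rank-∖-above av k j h k<j with av (suc j)
...   | true  = ≡.refl
...   | false = ≡.refl

-- Constructor forms, so that comparing letters of opposite signs computes.
letter : Bool → ℕ → ℤ
letter true  k = ℤ.+ suc k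
letter false k = ℤ.-[1+ k ]

-- From sums over words to the rank recursion.

module Enumeration {c ℓ} (R : CommutativeRing c ℓ) (x₀ x₁ y₀ y₁ : CommutativeRing.Carrier R) where
  open CommutativeRing R
  open FiniteSums R
  open SetoidReasoning setoid
  open SemiringSolver commutativeSemiring using (solve; _:=_; _:+_)

  letterWeight : Bool → Bool → Carrier
  letterWeight true  e = if e then x₀ else x₁
  letterWeight false e = if e then y₀ else y₁

  open RankRecursion R letterWeight

  sumMap : ∀ {A : Set} → (A → Carrier) → List A → Carrier
  sumMap f xs = sumR R (map f xs)

  sumMap-cong : ∀ {A : Set} {f g : A → Carrier} → (∀ x → f x ≈ g x) → ∀ xs → sumMap f xs ≈ sumMap g xs
  sumMap-cong h []       = refl
  sumMap-cong h (x ∷ xs) = +-cong (h x) (sumMap-cong h xs)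

  sumMap-++ : ∀ {A : Set} (f : A → Carrier) xs ys → sumMap f (xs ++ ys) ≈ sumMap f xs + sumMap f ys
  sumMap-++ f []       ys = sym (+-identityˡ _)
  sumMap-++ f (x ∷ xs) ys = trans (+-congˡ (sumMap-++ f xs ys)) (sym (+-assoc _ _ _))

  sumMap-concatMap : ∀ {A B : Set} (f : B → Carrier) (g : A → List B) xs →
                     sumMap f (concatMap g xs) ≈ sumMap (λ x → sumMap f (g x)) xs
  sumMap-concatMap f g []       = refl
  sumMap-concatMap f g (x ∷ xs) =
    trans (sumMap-++ f (g x) (concatMap g xs)) (+-congˡ (sumMap-concatMap f g xs))

  sumMap-* : ∀ {A : Set} a (f : A → Carrier) xs → sumMap (λ x → a * f x) xs ≈ a * sumMap f xs
  sumMap-* a f []       = sym (zeroʳ a)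
  sumMap-* a f (x ∷ xs) = trans (+-congˡ (sumMap-* a f xs)) (sym (distribˡ a _ _))

  sumMap-+ : ∀ {A : Set} (f g : A → Carrier) xs →
             sumMap (λ x → f x + g x) xs ≈ sumMap f xs + sumMap g xs
  sumMap-+ f g []       = sym (+-identityʳ 0#)
  sumMap-+ f g (x ∷ xs) = trans (+-congˡ (sumMap-+ f g xs))
    (solve 4 (λ a b c d → (a :+ b) :+ (c :+ d) := (a :+ c) :+ (b :+ d)) refl _ _ _ _)

  sumMap-0 : ∀ {A : Set} (xs : List A) → sumMap (λ _ → 0#) xs ≈ 0#
  sumMap-0 []       = refl
  sumMap-0 (x ∷ xs) = trans (+-identityˡ _) (sumMap-0 xs)

  sumMap-Σ< : ∀ {A : Set} n (h : A → ℕ → Carrier) xs →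
              sumMap (λ x → Σ< n (h x)) xs ≈ Σ< n (λ k → sumMap (λ x → h x k) xs)
  sumMap-Σ< zero    h xs = sumMap-0 xs
  sumMap-Σ< (suc n) h xs = trans (sumMap-+ (λ x → Σ< n (h x)) (λ x → h x n) xs) (+-congʳ (sumMap-Σ< n h xs))

  sumMap-filter : ∀ {A : Set} {p} {P : Pred A p} (P? : Decidable P) (f : A → Carrier) xs →
                  sumMap f (filter P? xs) ≈ sumMap (λ x → if does (P? x) then f x else 0#) xs
  sumMap-filter P? f [] = refl
  sumMap-filter P? f (x ∷ xs) with does (P? x)
  ... | true  = +-congˡ (sumMap-filter P? f xs)
  ... | false = trans (sumMap-filter P? f xs) (sym (+-identityˡ _))

  sumMap-signedLetters : ∀ n h → sumMap h (signedLetters n) ≈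
                         Σ< n (λ k → h (letter true k) + h (letter false k))
  sumMap-signedLetters n h = begin
    sumMap h (signedLetters n)
      ≈⟨ sumMap-concatMap h _ (upTo n) ⟩
    sumMap (λ k → h (letter true k) + (h (letter false k) + 0#)) (upTo n)
      ≈⟨ sumR-applyUpTo _ (λ k → k) n ⟩
    Σ< n (λ k → h (letter true k) + (h (letter false k) + 0#))
      ≈⟨ Σ<-cong n (λ _ → +-congˡ (+-identityʳ _)) ⟩
    Σ< n (λ k → h (letter true k) + h (letter false k)) ∎

  sumMap-words : ∀ n m (F : List ℤ → Carrier) → sumMap F (words n (suc m)) ≈
    Σ< n (λ k → sumMap (λ w → F (letter true k ∷ w)) (words n m)
              + sumMap (λ w → F (letter false k ∷ w)) (words n m))
  sumMap-words n m F = begin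
    sumMap F (words n (suc m))
      ≈⟨ sumMap-concatMap F _ (words n m) ⟩
    sumMap (λ w → sumMap F (map (_∷ w) (signedLetters n))) (words n m)
      ≈⟨ sumMap-cong (λ w → trans (reflexive (≡.cong (sumR R) (≡.sym (map-∘ (signedLetters n)))))
                                  (sumMap-signedLetters n (λ a → F (a ∷ w)))) (words n m) ⟩
    sumMap (λ w → Σ< n (λ k → F (letter true k ∷ w) + F (letter false k ∷ w))) (words n m)
      ≈⟨ sumMap-Σ< n _ (words n m) ⟩
    Σ< n (λ k → sumMap (λ w → F (letter true k ∷ w) + F (letter false k ∷ w)) (words n m))
      ≈⟨ Σ<-cong n (λ _ → sumMap-+ _ _ (words n m)) ⟩
    Σ< n (λ k → sumMap (λ w → F (letter true k ∷ w)) (words n m)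
              + sumMap (λ w → F (letter false k ∷ w)) (words n m)) ∎

  step : Bool → ℤ → ℤ → Carrier
  step e a b = letterWeight (does (a ℤ.<? b)) e

  wordWeight : Bool → ℤ → List ℤ → Carrier
  wordWeight = weightFrom R x₀ x₁ y₀ y₁

  -- Extension by zero keeps every sum over all words on a fixed alphabet; only `av` shrinks as
  -- letters are used.
  restricted : (ℕ → Bool) → Bool → ℤ → List ℤ → Carrier
  restricted av e a w = if admissible av (map ∣_∣ w) then wordWeight e a w else 0#

  wordWeight-∷ : ∀ e a b w → wordWeight e a (b ∷ w) ≈ step e a b * wordWeight (not e) b w
  wordWeight-∷ e a b w with does (a ℤ.<? b)
  ... | true  = refl
  ... | false = refl

  restricted-∷ : ∀ av e a b w → av ∣ b ∣ ≡ true →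
    restricted av e a (b ∷ w) ≈ step e a b * restricted (av ∖ ∣ b ∣) (not e) b w
  restricted-∷ av e a b w h rewrite h with admissible (av ∖ ∣ b ∣) (map ∣_∣ w)
  ... | true  = wordWeight-∷ e a b w
  ... | false = sym (zeroʳ _)

  restricted-∷-0 : ∀ av e a b w → av ∣ b ∣ ≡ false → restricted av e a (b ∷ w) ≈ 0#
  restricted-∷-0 av e a b w h rewrite h = refl

  -- Along the free indices in increasing order, `rank` takes the values 0, 1, 2, ... once each.
  Σ<-rank : ∀ av (g : ℕ → Carrier) k →
    Σ< k (λ i → if av (suc i) then g (rank av i) else 0#) ≈ Σ< (rank av k) g
  Σ<-rank av g zero = refl
  Σ<-rank av g (suc k) with av (suc k)
  ... | true  = +-congʳ (Σ<-rank av g k)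
  ... | false = trans (+-identityʳ _) (Σ<-rank av g k)

  +-sign : ∀ s (f : Bool → Carrier) → f true + f false ≈ f (not s) + f s
  +-sign true  f = +-comm _ _
  +-sign false f = refl

  step-opposite : ∀ e s j k → step e (letter s j) (letter (not s) k) ≈ letterWeight (not s) e
  step-opposite e true  j k = refl
  step-opposite e false j k = refl

  -- A smaller absolute value gives a descent between positive letters and an ascent between
  -- negative ones; either way the weight is the one indexed by `not s`.
  step-same : ∀ e s j k → j ≢ k → step e (letter s j) (letter s k) ≈
    (if k <ᵇ j then letterWeight (not s) e else letterWeight s e)
  step-same e true j k j≢k rewrite <ᵇ-flip j≢k with j <ᵇ k
  ... | true  = refl
  ... | false = refl
  step-same e false j k j≢k with k <ᵇ j
  ... | true  = refl
  ... | false = refl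

  module _ (n : ℕ) where

    G : (ℕ → Bool) → ℕ → Bool → ℤ → Carrier
    G av m e a = sumMap (restricted av e a) (words n m)

    G-∷ : ∀ av m e a b → av ∣ b ∣ ≡ true →
      sumMap (λ w → restricted av e a (b ∷ w)) (words n m) ≈ step e a b * G (av ∖ ∣ b ∣) m (not e) b
    G-∷ av m e a b h = trans (sumMap-cong (λ w → restricted-∷ av e a b w h) (words n m))
                             (sumMap-* (step e a b) _ (words n m))

    G-∷-0 : ∀ av m e a b → av ∣ b ∣ ≡ false →
      sumMap (λ w → restricted av e a (b ∷ w)) (words n m) ≈ 0#
    G-∷-0 av m e a b h = trans (sumMap-cong (λ w → restricted-∷-0 av e a b w h) (words n m))
                               (sumMap-0 (words n m))

    CompletesLetters : ℕ → Set ℓ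
    CompletesLetters m = ∀ av e s k → rank av n ≡ m → av (suc k) ≡ false →
      G av m e (letter s k) ≈ completions s m (rank av k) e

    -- The entry `a` enters only through the weights of the steps leaving it, so that both an actual
    -- letter and the initial 0 are covered.
    G-suc : ∀ {m} → CompletesLetters m → ∀ av e s a j → rank av n ≡ suc m →
      (∀ k → av (suc k) ≡ true → step e a (letter (not s) k) ≈ letterWeight (not s) e) →
      (∀ k → av (suc k) ≡ true → step e a (letter s k) ≈
        (if rank av k <ᵇ j then letterWeight (not s) e else letterWeight s e)) →
      G av (suc m) e a ≈ completions s (suc m) j e
    G-suc {m} IH av e s a j rank≡ h⁻ h⁺ = begin
      G av (suc m) e a
        ≈⟨ sumMap-words n m (restricted av e a) ⟩
      Σ< n (λ k → next true k + next false k)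
        ≈⟨ Σ<-cong n (λ {k} k<n → term k k<n ≡.refl) ⟩
      Σ< n (λ k → if av (suc k) then g (rank av k) else 0#)
        ≈⟨ Σ<-rank av g n ⟩
      Σ< (rank av n) g
        ≈⟨ reflexive (≡.cong (λ r → Σ< r g) rank≡) ⟩
      Σ< (suc m) g ∎
      where
      g : ℕ → Carrier
      g i = letterWeight (not s) e * completions (not s) m i (not e)
          + (if i <ᵇ j then letterWeight (not s) e else letterWeight s e) * completions s m i (not e)

      next : Bool → ℕ → Carrier
      next s k = sumMap (λ w → restricted av e a (letter s k ∷ w)) (words n m)

      abs-letter : ∀ s k → ∣ letter s k ∣ ≡ suc k
      abs-letter true  k = ≡.refl
      abs-letter false k = ≡.refl

      next-used : ∀ s k → av (suc k) ≡ false → next s k ≈ 0#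
      next-used s k h = G-∷-0 av m e a (letter s k) (≡.trans (≡.cong av (abs-letter s k)) h)

      next-free : ∀ s k → k ℕ.< n → av (suc k) ≡ true →
        next s k ≈ step e a (letter s k) * completions s m (rank av k) (not e)
      next-free s k k<n h = begin
        next s k
          ≈⟨ G-∷ av m e a (letter s k) (≡.trans (≡.cong av (abs-letter s k)) h) ⟩
        step e a (letter s k) * G (av ∖ ∣ letter s k ∣) m (not e) (letter s k)
          ≈⟨ *-congˡ (reflexive (≡.cong (λ i → G (av ∖ i) m (not e) (letter s k)) (abs-letter s k))) ⟩
        step e a (letter s k) * G (av ∖ suc k) m (not e) (letter s k)
          ≈⟨ *-congˡ (IH (av ∖ suc k) (not e) s k
               (ℕₚ.suc-injective (≡.trans (≡.sym (rank-∖-above av k n h k<n)) rank≡)) (∖-self av (suc k))) ⟩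
        step e a (letter s k) * completions s m (rank (av ∖ suc k) k) (not e)
          ≈⟨ *-congˡ (reflexive (≡.cong (λ i → completions s m i (not e)) (rank-∖-below av k k ℕₚ.≤-refl))) ⟩
        step e a (letter s k) * completions s m (rank av k) (not e) ∎

      term : ∀ k → k ℕ.< n → ∀ {t} → av (suc k) ≡ t →
        next true k + next false k ≈ (if t then g (rank av k) else 0#)
      term k k<n {false} h =
        trans (+-cong (next-used true k h) (next-used false k h)) (+-identityʳ 0#)
      term k k<n {true} h = trans (+-sign s (λ s → next s k))
        (+-cong (trans (next-free (not s) k k<n h) (*-congʳ (h⁻ k h)))
                (trans (next-free s k k<n h) (*-congʳ (h⁺ k h))))

    G≈completions : ∀ m → CompletesLetters m
    G≈completions zero    av e s k rank≡ h = +-identityʳ 1#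
    G≈completions (suc m) av e s k rank≡ h =
      G-suc (G≈completions m) av e s (letter s k) (rank av k) rank≡
        (λ i _ → step-opposite e s k i)
        (λ i free → trans
          (step-same e s k i (λ { ≡.refl → contradiction (≡.trans (≡.sym free) h) λ () }))
          (reflexive (≡.cong (λ t → if t then letterWeight (not s) e else letterWeight s e)
                             (≡.sym (rank-<ᵇ av k free)))))

    G≈Z : ∀ m av e → rank av n ≡ m → G av m e (ℤ.+ 0) ≈ Z e m
    G≈Z zero    av e rank≡ = +-identityʳ 1#
    G≈Z (suc m) av e rank≡ =
      G-suc (G≈completions m) av e true (ℤ.+ 0) 0 rank≡ (λ _ _ → refl) (λ _ _ → refl)

  PB≈Z : ∀ n → PB R n x₀ x₁ y₀ y₁ ≈ Z true n
  PB≈Z n = begin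
    PB R n x₀ x₁ y₀ y₁
      ≈⟨ sumMap-filter (λ w → UniqueDec.unique? (map ∣_∣ w)) (weight R x₀ x₁ y₀ y₁) (words n n) ⟩
    sumMap (λ w → if does (UniqueDec.unique? (map ∣_∣ w)) then weight R x₀ x₁ y₀ y₁ w else 0#) (words n n)
      ≈⟨ sumMap-cong (λ w → reflexive (≡.cong (λ t → if t then weight R x₀ x₁ y₀ y₁ w else 0#)
                                              (does-unique? (map ∣_∣ w)))) (words n n) ⟩
    G n (λ _ → true) n true (ℤ.+ 0)
      ≈⟨ G≈Z n n (λ _ → true) true (rank-full n) ⟩
    Z true n ∎

-- Elimination in a commutative ring.

module Elimination {c ℓ} (K : CommutativeRing c ℓ) where
  open CommutativeRing K
  open import Algebra.Properties.Ring ring using (+-cancelʳ)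
  open SetoidReasoning setoid
  open SemiringSolver commutativeSemiring using (solve; _:=_; _:+_; _:*_; con)

  -- Multiplying the equation for `Z₀` by `C` and inserting the one for `Z₁` leaves an equation in
  -- `Z₀` alone, which is then multiplied by α. The hypotheses avoid subtraction so that the
  -- semiring solver applies.
  eliminate : ∀ {α p b c₀ c₁ C S Z₀ Z₁ E D} →
    p ≈ α + b → c₀ * c₁ ≈ p + b →
    C * C ≈ 1# + α * (S * S) → E ≈ 1# + (α + α) * (S * S) → D + b * E ≈ p →
    C * Z₀ ≈ 1# + c₀ * (S * Z₁) → C * Z₁ ≈ 1# + c₁ * (S * Z₀) →
    D * Z₀ ≈ α * C + (α * c₀) * S
  eliminate {α} {p} {b} {c₀} {c₁} {C} {S} {Z₀} {Z₁} {E} {D} hp hc hC hE hD h₀ h₁ =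
    -- `X` is (b E + α² S²) Z₀ with `E` expanded: its first part completes `D` to `p`, its second
    -- completes α to α C².
    +-cancelʳ X (D * Z₀) (α * C + (α * c₀) * S) (begin
      D * Z₀ + X
        ≈⟨ solve 5 (λ D Z a b s → D :* Z :+ (b :* (con 1 :+ (a :+ a) :* s) :+ a :* (a :* s)) :* Z
                        := (D :+ b :* (con 1 :+ (a :+ a) :* s)) :* Z :+ (a :* (a :* s)) :* Z) refl _ _ _ _ _ ⟩
      (D + b * (1# + (α + α) * (S * S))) * Z₀ + (α * (α * (S * S))) * Z₀
        ≈⟨ +-congʳ (*-congʳ (trans (+-congˡ (*-congˡ (sym hE))) (trans hD hp))) ⟩
      (α + b) * Z₀ + (α * (α * (S * S))) * Z₀
        ≈⟨ solve 4 (λ Z a b s → (a :+ b) :* Z :+ (a :* (a :* s)) :* Z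
                        := b :* Z :+ a :* ((con 1 :+ a :* s) :* Z)) refl _ _ _ _ ⟩
      b * Z₀ + α * ((1# + α * (S * S)) * Z₀)
        ≈⟨ +-congˡ (*-congˡ C²Z₀) ⟩
      b * Z₀ + α * (C + c₀ * (S * (1# + c₁ * (S * Z₀))))
        ≈⟨ solve 7 (λ Z a b C c₀ S c₁ → b :* Z :+ a :* (C :+ c₀ :* (S :* (con 1 :+ c₁ :* (S :* Z))))
                        := (a :* C :+ (a :* c₀) :* S) :+ (b :+ a :* ((c₀ :* c₁) :* (S :* S))) :* Z) refl _ _ _ _ _ _ _ ⟩
      (α * C + (α * c₀) * S) + (b + α * ((c₀ * c₁) * (S * S))) * Z₀
        ≈⟨ +-congˡ (*-congʳ (+-congˡ (*-congˡ (*-congʳ (trans hc (+-congʳ hp)))))) ⟩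
      (α * C + (α * c₀) * S) + (b + α * (((α + b) + b) * (S * S))) * Z₀
        ≈⟨ +-congˡ (*-congʳ (solve 3 (λ a b s → b :+ a :* (((a :+ b) :+ b) :* s)
                        := b :* (con 1 :+ (a :+ a) :* s) :+ a :* (a :* s)) refl _ _ _)) ⟩
      (α * C + (α * c₀) * S) + X ∎)
    where
    X = (b * (1# + (α + α) * (S * S)) + α * (α * (S * S))) * Z₀
    C²Z₀ : (1# + α * (S * S)) * Z₀ ≈ C + c₀ * (S * (1# + c₁ * (S * Z₀)))
    C²Z₀ = begin
      (1# + α * (S * S)) * Z₀             ≈⟨ *-congʳ hC ⟨
      (C * C) * Z₀                        ≈⟨ *-assoc C C Z₀ ⟩
      C * (C * Z₀)                        ≈⟨ *-congˡ h₀ ⟩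
      C * (1# + c₀ * (S * Z₁))
        ≈⟨ solve 4 (λ C c S Z → C :* (con 1 :+ c :* (S :* Z)) := C :+ c :* (S :* (C :* Z))) refl _ _ _ _ ⟩
      C + c₀ * (S * (C * Z₁))             ≈⟨ +-congˡ (*-congˡ (*-congˡ h₁)) ⟩
      C + c₀ * (S * (1# + c₁ * (S * Z₀))) ∎

-- The two generating function identities.

module MainIdentity {c ℓ} (R : CommutativeRing c ℓ) (x₀ x₁ y₀ y₁ : CommutativeRing.Carrier R) where
  open CommutativeRing R
  open import Algebra.Properties.Ring ring using (-‿distribˡ-*; +-cancelʳ)
  open ExponentialSeries R
  open SetoidReasoning setoid
  open SemiringSolver commutativeSemiring using (solve; _:=_; _:+_; _:*_)
  module 𝕊 = CommutativeRing seriesRing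

  α p b : Carrier
  α = (y₀ - x₀) * (y₁ - x₁)
  p = x₀ * x₁ + y₀ * y₁
  b = x₀ * y₁ + x₁ * y₀

  open Hyperbolic R α

  open Enumeration R x₀ x₁ y₀ y₁ using (letterWeight; PB≈Z)
  open RankRecursion R letterWeight

  den : Series R
  den m = const p m - b * cosh₂ m

  cancel : ∀ {u v} → (u - v) + v ≈ u
  cancel {u} {v} = trans (+-assoc _ _ _) (trans (+-congˡ (-‿inverseˡ v)) (+-identityʳ u))

  -- This is the expansion of `α`, made free of subtraction by writing each y as x plus the
  -- difference.
  p≈α+b : p ≈ α + b
  p≈α+b = begin
    x₀ * x₁ + y₀ * y₁
      ≈⟨ +-congˡ (*-cong (z-not true true) (z-not true false)) ⟩
    x₀ * x₁ + (x₀ + d₀) * (x₁ + d₁)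
      ≈⟨ solve 4 (λ x₀ x₁ d₀ d₁ → x₀ :* x₁ :+ (x₀ :+ d₀) :* (x₁ :+ d₁)
                     := d₀ :* d₁ :+ (x₀ :* (x₁ :+ d₁) :+ x₁ :* (x₀ :+ d₀))) refl _ _ _ _ ⟩
    d₀ * d₁ + (x₀ * (x₁ + d₁) + x₁ * (x₀ + d₀))
      ≈⟨ +-congˡ (+-cong (*-congˡ (z-not true false)) (*-congˡ (z-not true true))) ⟨
    α + b ∎
    where
    d₀ = y₀ - x₀
    d₁ = y₁ - x₁

  -- The elimination takes place in the ring of series, with scalars embedded as constant series.
  den-⊙-Z : ∀ m → (den ⊙ Z true) m ≈ α * cosh m + (α * (x₀ + y₀)) * sinh m
  den-⊙-Z m = trans (eliminate
      (𝕊.trans (const-cong p≈α+b) (const-+ α b))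
      (𝕊.trans (𝕊.sym (const-* (x₀ + y₀) (x₁ + y₁)))
         (𝕊.trans (const-cong (solve 4 (λ x₀ x₁ y₀ y₁ → (x₀ :+ y₀) :* (x₁ :+ y₁)
               := (x₀ :* x₁ :+ y₀ :* y₁) :+ (x₀ :* y₁ :+ x₁ :* y₀)) refl _ _ _ _))
            (const-+ p b)))
      cosh²
      (𝕊.trans cosh₂-duplication (𝕊.+-congˡ {const 1#} (𝕊.*-congʳ {sinh ⊙ sinh} (const-+ α α))))
      (λ k → trans (+-congˡ (const-⊙ b cosh₂ k)) cancel)
      (λ k → trans (cosh-Z α refl true k) (+-congˡ (sym (const-⊙ (x₀ + y₀) (sinh ⊙ Z false) k))))
      (λ k → trans (cosh-Z α refl false k) (+-congˡ (sym (const-⊙ (x₁ + y₁) (sinh ⊙ Z true) k))))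
      m)
    (+-cong (const-⊙ α cosh m)
            (trans (⊙-cong (𝕊.sym (const-* α (x₀ + y₀))) (λ _ → refl) m) (const-⊙ _ sinh m)))
    where
    open Elimination seriesRing

  den-isEven : IsEven den
  den-isEven m = begin
    oddPart den m
      ≈⟨ oddPart-cong {G = const p ⊞ (λ k → - b * cosh₂ k)} (λ k → +-congˡ (-‿distribˡ-* b (cosh₂ k))) m ⟩
    oddPart (const p ⊞ (λ k → - b * cosh₂ k)) m
      ≈⟨ oddPart-⊞ (const p) (λ k → - b * cosh₂ k) m ⟩
    oddPart (const p) m + oddPart (λ k → - b * cosh₂ k) m
      ≈⟨ +-cong (const-isEven p m) (trans (oddPart-* (- b) cosh₂ m) (*-congˡ (oddPart-evenS _ m))) ⟩
    0# + - b * 0#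
      ≈⟨ trans (+-identityˡ _) (zeroʳ _) ⟩
    0# ∎

  den-⊙-evenPart : ∀ m → (den ⊙ evenPart (Z true)) m ≈ α * cosh m
  den-⊙-evenPart m = begin
    (den ⊙ evenPart (Z true)) m
      ≈⟨ evenPart-⊙ den (Z true) den-isEven m ⟨
    evenPart (den ⊙ Z true) m
      ≈⟨ evenPart-cong den-⊙-Z m ⟩
    evenPart ((λ k → α * cosh k) ⊞ (λ k → (α * (x₀ + y₀)) * sinh k)) m
      ≈⟨ evenPart-⊞ (λ k → α * cosh k) (λ k → (α * (x₀ + y₀)) * sinh k) m ⟩
    evenPart (λ k → α * cosh k) m + evenPart (λ k → (α * (x₀ + y₀)) * sinh k) m
      ≈⟨ +-cong (trans (evenPart-* α cosh m) (*-congˡ (evenPart-evenS _ m)))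
                (trans (evenPart-* _ sinh m) (trans (*-congˡ (evenPart-oddS _ m)) (zeroʳ _))) ⟩
    α * cosh m + 0#
      ≈⟨ +-identityʳ _ ⟩
    α * cosh m ∎

  den-⊙-oddPart : ∀ m → (den ⊙ oddPart (Z true)) m ≈ (α * (x₀ + y₀)) * sinh m
  den-⊙-oddPart m = begin
    (den ⊙ oddPart (Z true)) m
      ≈⟨ oddPart-⊙ den (Z true) den-isEven m ⟨
    oddPart (den ⊙ Z true) m
      ≈⟨ oddPart-cong den-⊙-Z m ⟩
    oddPart ((λ k → α * cosh k) ⊞ (λ k → (α * (x₀ + y₀)) * sinh k)) m
      ≈⟨ oddPart-⊞ (λ k → α * cosh k) (λ k → (α * (x₀ + y₀)) * sinh k) m ⟩
    oddPart (λ k → α * cosh k) m + oddPart (λ k → (α * (x₀ + y₀)) * sinh k) m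
      ≈⟨ +-cong (trans (oddPart-* α cosh m) (trans (*-congˡ (oddPart-evenS _ m)) (zeroʳ _)))
                (trans (oddPart-* _ sinh m) (*-congˡ (oddPart-oddS _ m))) ⟩
    0# + (α * (x₀ + y₀)) * sinh m
      ≈⟨ +-identityˡ _ ⟩
    (α * (x₀ + y₀)) * sinh m ∎

  evenPB oddPB : Series R
  evenPB = evenS R (PBevenCoeff R x₀ x₁ y₀ y₁)
  oddPB = oddS R (λ n → PB R (2 ℕ.* n ℕ.+ 1) x₀ x₁ y₀ y₁)

  -- `Z true` has the empty word in degree 0, whereas the series of the theorem starts at n = 1.
  evenPB+1≋ : evenPB ⊞ const 1# ≋ evenPart (Z true)
  evenPB+1≋ zero          = +-identityˡ 1#
  evenPB+1≋ (suc zero)    = +-identityˡ 0#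
  evenPB+1≋ (suc (suc m)) = trans (+-identityʳ _) (evenS≋evenPart (∂ (∂ (Z true)))
    (λ k → trans (PB≈Z (2 ℕ.* suc k)) (reflexive (≡.cong (Z true) (ℕₚ.*-suc 2 k)))) m)

  oddPB≋ : oddPB ≋ oddPart (Z true)
  oddPB≋ zero    = refl
  oddPB≋ (suc m) = evenS≋evenPart (∂ (Z true))
    (λ k → trans (PB≈Z (2 ℕ.* k ℕ.+ 1)) (reflexive (≡.cong (Z true) (ℕₚ.+-comm (2 ℕ.* k) 1)))) m

  den-⊙-evenPB : ∀ m → (den ⊙ evenPB) m ≈ ((b * cosh₂ m) + α * cosh m) - const p m
  -- On the left the added `den` supplies the missing constant term 1; on the right it cancels
  -- everything but α `cosh`.
  den-⊙-evenPB m = +-cancelʳ (den m) _ _ (begin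
    (den ⊙ evenPB) m + den m
      ≈⟨ +-congˡ (𝕊.*-identityʳ den m) ⟨
    (den ⊙ evenPB) m + (den ⊙ const 1#) m
      ≈⟨ ⊙-distribˡ den evenPB (const 1#) m ⟨
    (den ⊙ (evenPB ⊞ const 1#)) m
      ≈⟨ ⊙-cong {den} (λ _ → refl) evenPB+1≋ m ⟩
    (den ⊙ evenPart (Z true)) m
      ≈⟨ den-⊙-evenPart m ⟩
    α * cosh m
      ≈⟨ trans (+-congʳ (+-cong (-‿inverseˡ (const p m)) (-‿inverseˡ (b * cosh₂ m))))
           (trans (+-congʳ (+-identityʳ 0#)) (+-identityˡ _)) ⟨
    ((- const p m + const p m) + (- (b * cosh₂ m) + b * cosh₂ m)) + α * cosh m
      ≈⟨ solve 5 (λ p p′ q q′ r → ((p′ :+ p) :+ (q′ :+ q)) :+ r := ((q :+ r) :+ p′) :+ (p :+ q′)) refl _ _ _ _ _ ⟩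
    (((b * cosh₂ m) + α * cosh m) - const p m) + den m ∎)

  den-⊙-oddPB : ∀ m → (den ⊙ oddPB) m ≈ ((y₀ * y₀ - x₀ * x₀) * (y₁ - x₁)) * sinh m
  den-⊙-oddPB m = trans (⊙-cong {den} (λ _ → refl) oddPB≋ m)
    (trans (den-⊙-oddPart m) (*-congʳ (begin
      ((y₀ - x₀) * (y₁ - x₁)) * (x₀ + y₀)
        -- `n` stands for - x₀, which the solver treats as an independent variable; the next step
        -- cancels `x + n`.
        ≈⟨ solve 4 (λ y n x d → ((y :+ n) :* d) :* (x :+ y)
                       := (y :* y :+ (y :* (x :+ n) :+ n :* x)) :* d) refl _ _ _ _ ⟩
      (y₀ * y₀ + (y₀ * (x₀ - x₀) + - x₀ * x₀)) * (y₁ - x₁)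
        ≈⟨ *-congʳ (+-congˡ (trans
             (+-cong (trans (*-congˡ (-‿inverseʳ x₀)) (zeroʳ y₀)) (sym (-‿distribˡ-* x₀ x₀))) (+-identityˡ _))) ⟩
      (y₀ * y₀ - x₀ * x₀) * (y₁ - x₁) ∎)))

theorem1p4 : ∀ {c ℓ} (R : CommutativeRing c ℓ) (x₀ x₁ y₀ y₁ : CommutativeRing.Carrier R) →
  let open CommutativeRing R
      α = (y₀ - x₀) * (y₁ - x₁)
      -- Σ_{n≥0} α^n (2t)^{2n}/(2n)!
      E2 = evenS R (λ n → pow R α n * pow R (1# + 1#) (2 ℕ.* n))
      -- Σ_{n≥0} α^{n+1} t^{2n}/(2n)!
      E1 = evenS R (λ n → pow R α (ℕ.suc n))
      -- Σ_{n≥0} α^n t^{2n+1}/(2n+1)!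
      O1 = oddS R (λ n → pow R α n)
      -- Σ_{n≥1} P^B_{2n} t^{2n}/(2n)!
      Leven = evenS R (PBevenCoeff R x₀ x₁ y₀ y₁)
      -- Σ_{n≥1} P^B_{2n-1} t^{2n-1}/(2n-1)!
      Lodd = oddS R (λ n → PB R (2 ℕ.* n ℕ.+ 1) x₀ x₁ y₀ y₁)
      Den1 = _⊖_ R (constS R (x₀ * x₁ + y₀ * y₁)) (_·ₛ_ R (y₁ * x₀ + x₁ * y₀) E2)
      Den2 = _⊖_ R (constS R (x₀ * x₁ + y₀ * y₁)) (_·ₛ_ R (x₀ * y₁ + x₁ * y₀) E2)
      Num1 = _⊖_ R (_⊕_ R (_·ₛ_ R (x₀ * y₁ + x₁ * y₀) E2) E1) (constS R (x₁ * x₀ + y₀ * y₁))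
      Num2 = _·ₛ_ R ((y₀ * y₀ - x₀ * x₀) * (y₁ - x₁)) O1
  in (∀ m → _⊛_ R Den1 Leven m ≈ Num1 m)
   × (∀ m → _⊛_ R Den2 Lodd m ≈ Num2 m)
theorem1p4 R x₀ x₁ y₀ y₁ =
  (λ m → trans (⊛≋⊙ _ evenPB m)
    -- The two denominators differ only in the order of the factors y₁ and x₀; this brings the first
    -- one to `den`.
    (trans (⊙-cong {G = evenPB} (λ k → +-congˡ (-‿cong (*-congʳ (+-congʳ (*-comm y₁ x₀))))) (λ _ → refl) m)
    (trans (den-⊙-evenPB m)
      -- The factor α in front of `cosh` accounts for the exponent n + 1 in the numerator.
      (+-cong (+-congˡ (sym (evenS-* α (pow R α) m)))
              (-‿cong (const-cong (+-congʳ (*-comm x₀ x₁)) m)))))) ,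
  (λ m → trans (⊛≋⊙ _ oddPB m) (den-⊙-oddPB m))
  where
  open CommutativeRing R
  open ExponentialSeries R
  open MainIdentity R x₀ x₁ y₀ y₁
  open Hyperbolic R α using (evenS-*)
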